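{- Let $M=(S,P,I,AP,L)$ be a possibilistic Kripke structure and let $B,C\subseteq S$. Let $S_{=0},S_{=1},S_{?}$ be a partition of $S$ such that (1) $B\subseteq S_{=1}\subseteq\{s\in S\mid Po(s\models C\,\mathsf{U}\,B)=1\}$; (2) $S\setminus(C\cup B)\subseteq S_{=0}\subseteq\{s\in S\mid Po(s\models C\,\mathsf{U}\,B)=0\}$; (3) $S_{?}=S\setminus(S_{=1}\cup S_{=0})$. Let $A=(P(s,t))_{s,t\in S_?}$ and $b=(b_s)_{s\in S_?}$ with $b_s=P(s,S_{=1})=\bigvee_{u\in S_{=1}}P(s,u)$, and define $\Phi:[0,1]^{S_?}\to[0,1]^{S_?}$ by $\Phi(Y)=(A\circ Y)\vee b$, i.e. $\Phi(Y)_s=\bigvee_{t\in S_?}\big(P(s,t)\wedge y_t\big)\vee b_s$ for $Y=(y_t)_{t\in S_?}$ and $s\in S_?$. Then: (i) The vector $X=(Po(s\models C\,\mathsf{U}\,B))_{s\in S_?}$ is the least fixed point of $\Phi$ (with respect to the pointwise order on $[0,1]^{S_?}$). (ii) Let $X^{(0)}=0$ be the vector consisting of zeros only and, for $n\ge 0$, $X^{(n+1)}=\Phi(X^{(n)})$. Then (ii-1) $X^{(n)}=(x^{(n)}_s)_{s\in S_?}$, where $x^{(n)}_s=Po(s\models C\,\mathsf{U}^{\le n}S_{=1})$ for each $s\in S_?$ and each $n\geq 0$; (ii-2) $X^{(0)}\le X^{(1)}\le X^{(2)}\le\cdots\le X$; (ii-3) $X=\lim_{n\to\infty}X^{(n)}$,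 meaning that $x_s=\lim_{n\to\infty}x_s^{(n)}$ for every $s\in S_?$, where $X=(x_s)_{s\in S_?}$.
   Context: For subsets or families in $[0,1]$, $\vee$ denotes supremum and $\wedge$ infimum. A possibilistic Kripke structure is a tuple $M=(S,P,I,AP,L)$ where $S$ is a countable nonempty set of states; $P:S\times S\to[0,1]$ satisfies $\bigvee_{s'\in S}P(s,s')=1$ for all $s\in S$; $I:S\to[0,1]$ satisfies $\bigvee_{s\in S}I(s)=1$; $AP$ is a set of atomic propositions; and $L:S\to 2^{AP}$ is a labeling function. For $T\subseteq S$, $P(s,T)=\bigvee_{t\in T}P(s,t)$. A path of $M$ is an infinite sequence $\pi=s_0s_1s_2\cdots\in S^\omega$ with $P(s_i,s_{i+1})>0$ for all $i\ge 0$; $Paths(M)$ is the set of all paths and $Paths(s)$ the set of those with $s_0=s$. Define $Po^M(\pi)=I(s_0)\wedge\bigwedge_{i=0}^\infty P(s_i,s_{i+1})$ for $\pi=s_0s_1\cdots\in Paths(M)$, and $Po^M(E)=\bigvee\{Po^M(\pi)\mid\pi\in E\}$ for $E\subseteq Paths(M)$ (with $\bigvee\emptyset=0$). For a state $s$, $M_s$ is the structure obtained from $M$ by replacing $I$ with the initial distribution that is $1$ at $s$ and $0$ elsewhere. For an event (set of paths) $E$, $Po(s\models E)=Po^{M_s}(E\cap Paths(s))$. For $C,D\subseteq S$ and $n\ge0$: $C\,\mathsf{U}\,D$ is the set of paths $s_0s_1\cdots$ for which there is $k\ge 0$ with $s_k\in D$ and $s_i\in C$ for all $0\le i<k$; $C\,\mathsf{U}^{\le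 n}D$ is the set of paths for which such a $k$ exists with $k\le n$. -}

module Defs where

open import Data.Bool.Base using (if_then_else_)
open import Data.Empty using (⊥-elim)
open import Data.Nat.Base as ℕ using (ℕ; zero; suc)
import Data.Nat.Properties as ℕ
open import Data.Product.Base using (Σ; ∃; _×_; _,_; proj₁; proj₂)
open import Data.Rational.Base as ℚ using (ℚ; 0ℚ; 1ℚ)
import Data.Rational.Properties as ℚ
open import Data.Rational.Solver using (module +-*-Solver)
open import Data.Refinement.Base using (Refinement; value)
open import Data.Sum.Base as Sum using (_⊎_; inj₁; inj₂)
open import Function.Base using (_∘_; id)
open import Function.Bundles using (_↣_)
open import Level using (0ℓ)
open import Relation.Binary.Definitions using (DecidableEquality; tri<; tri≈; tri>)
open import Relation.Binary.PropositionalEquality using (_≡_; refl; sym; subst)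
open import Relation.Nullary.Decidable using (does; dec-true)
open import Relation.Unary using (Pred; _∈_; _∉_; _⊆_; _∪_; _∩_; _⊥_; U)

open +-*-Solver using (solve; _:=_; _:+_; :-_)

private
  p-1<p : ∀ p → p ℚ.- 1ℚ ℚ.< p
  p-1<p p = subst (p ℚ.- 1ℚ ℚ.<_) (ℚ.+-identityʳ p)
    (ℚ.+-monoʳ-< p (ℚ.negative⁻¹ (ℚ.- 1ℚ)))

------------------------------------------------------------------------
-- Real numbers as Dedekind (lower) cuts of ℚ: nonempty proper subsets of
-- ℚ that are downward closed and have no largest element.  These are the
-- usual reals under excluded middle; without it a lower cut need not be
-- located, but arbitrary suprema still exist.

record ℝ : Set₁ where
  field
    cut       : Pred ℚ 0ℓ
    inhabited : ∃ λ q → q ∈ cut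
    proper    : ∃ λ q → q ∉ cut
    closed    : ∀ {p q} → p ℚ.< q → q ∈ cut → p ∈ cut
    open′     : ∀ {q} → q ∈ cut → ∃ λ r → q ℚ.< r × r ∈ cut

  below : ∀ {p q} → p ∈ cut → q ∉ cut → p ℚ.< q
  below {p} {q} p∈ q∉ with ℚ.<-cmp p q
  ... | tri< p<q _ _ = p<q
  ... | tri≈ _ refl _ = ⊥-elim (q∉ p∈)
  ... | tri> _ _ q<p = ⊥-elim (q∉ (closed q<p p∈))

open ℝ public using (cut)
open ℝ

infix 4 _≤ᴿ_ _<ᴿ_
infixl 6 _+ᴿ_ _-ᴿ_
infix 8 -ᴿ_

_≤ᴿ_ : ℝ → ℝ → Set
x ≤ᴿ y = cut x ⊆ cut y

_<ᴿ_ : ℝ → ℝ → Set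
x <ᴿ y = ∃ λ q → q ∉ cut x × q ∈ cut y

fromℚ : ℚ → ℝ
fromℚ p = record
  { cut       = ℚ._< p
  ; inhabited = p ℚ.- 1ℚ , p-1<p p
  ; proper    = p , ℚ.<-irrefl refl
  ; closed    = ℚ.<-trans
  ; open′     = λ q<p → let (m , q<m , m<p) = ℚ.<-dense q<p in m , q<m , m<p
  }

0ᴿ 1ᴿ : ℝ
0ᴿ = fromℚ 0ℚ
1ᴿ = fromℚ 1ℚ

_+ᴿ_ : ℝ → ℝ → ℝ
x +ᴿ y = record
  { cut       = λ q → ∃ λ r → ∃ λ s → r ∈ cut x × s ∈ cut y × q ≡ r ℚ.+ s
  ; inhabited = let (r , r∈) = inhabited x ; (s , s∈) = inhabited y in
                r ℚ.+ s , r , s , r∈ , s∈ , refl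
  ; proper    = let (r , r∉) = proper x ; (s , s∉) = proper y in
                r ℚ.+ s , λ { (a , b , a∈ , b∈ , eq) →
                  ℚ.<-irrefl (sym eq) (ℚ.+-mono-< (below x a∈ r∉) (below y b∈ s∉)) }
  ; closed    = λ { {p} p<q (r , s , r∈ , s∈ , refl) →
                  r , p ℚ.- r , r∈
                  , closed y (subst (p ℚ.- r ℚ.<_) (lem₁ r s) (ℚ.+-monoˡ-< (ℚ.- r) p<q)) s∈
                  , lem₂ p r }
  ; open′     = λ { (r , s , r∈ , s∈ , refl) →
                  let (r′ , r<r′ , r′∈) = open′ x r∈ in
                  r′ ℚ.+ s , ℚ.+-monoˡ-< s r<r′ , r′ , s , r′∈ , s∈ , refl }
  }
  where
  lem₁ : ∀ r s → (r ℚ.+ s) ℚ.- r ≡ s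
  lem₁ = solve 2 (λ r s → (r :+ s) :+ (:- r) := s) refl
  lem₂ : ∀ p r → p ≡ r ℚ.+ (p ℚ.- r)
  lem₂ = solve 2 (λ p r → p := r :+ (p :+ (:- r))) refl

-- The strict inequality p < r removes the largest element that
-- { p ∣ - p ∉ x } has when x is rational.
-ᴿ_ : ℝ → ℝ
-ᴿ x = record
  { cut       = λ p → ∃ λ r → p ℚ.< r × (ℚ.- r) ∉ cut x
  ; inhabited = let (s , s∉) = proper x in
                (ℚ.- s) ℚ.- 1ℚ , ℚ.- s , p-1<p (ℚ.- s) , s∉ ∘ subst (cut x) (neg-involutive s)
  ; proper    = let (q , q∈) = inhabited x in
                ℚ.- q , λ { (r , -q<r , -r∉) →
                  -r∉ (closed x (subst (ℚ.- r ℚ.<_) (neg-involutive q) (ℚ.neg-antimono-< -q<r)) q∈) }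
  ; closed    = λ { p<q (r , q<r , -r∉) → r , ℚ.<-trans p<q q<r , -r∉ }
  ; open′     = λ { (r , q<r , -r∉) →
                  let (m , q<m , m<r) = ℚ.<-dense q<r in m , q<m , r , m<r , -r∉ }
  }
  where
  neg-involutive : ∀ q → ℚ.- (ℚ.- q) ≡ q
  neg-involutive = solve 1 (λ q → :- (:- q) := q) refl

_-ᴿ_ : ℝ → ℝ → ℝ
x -ᴿ y = x +ᴿ (-ᴿ y)

maxᴿ : ℝ → ℝ → ℝ
maxᴿ x y = record
  { cut       = cut x ∪ cut y
  ; inhabited = let (q , q∈) = inhabited x in q , inj₁ q∈
  ; proper    = bound
  ; closed    = λ p<q → Sum.map (closed x p<q) (closed y p<q)
  ; open′     = λ { (inj₁ q∈) → let (r , q<r , r∈) = open′ x q∈ in r , q<r , inj₁ r∈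
                  ; (inj₂ q∈) → let (r , q<r , r∈) = open′ y q∈ in r , q<r , inj₂ r∈ }
  }
  where
  bound : ∃ λ q → q ∉ cut x ∪ cut y
  bound with proper x | proper y
  ... | a , a∉ | b , b∉ with ℚ.<-cmp a b
  ... | tri< a<b _ _ = b , Sum.[ a∉ ∘ closed x a<b , b∉ ]
  ... | tri≈ _ refl _ = b , Sum.[ a∉ , b∉ ]
  ... | tri> _ _ b<a = a , Sum.[ a∉ , b∉ ∘ closed y b<a ]

minᴿ : ℝ → ℝ → ℝ
minᴿ x y = record
  { cut       = cut x ∩ cut y
  ; inhabited = inh
  ; proper    = let (q , q∉) = proper x in q , q∉ ∘ proj₁
  ; closed    = λ { p<q (q∈x , q∈y) → closed x p<q q∈x , closed y p<q q∈y }
  ; open′     = λ (q∈x , q∈y) → opn q∈x q∈y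
  }
  where
  inh : ∃ λ q → q ∈ cut x ∩ cut y
  inh with inhabited x | inhabited y
  ... | a , a∈ | b , b∈ with ℚ.<-cmp a b
  ... | tri< a<b _ _ = a , a∈ , closed y a<b b∈
  ... | tri≈ _ refl _ = a , a∈ , b∈
  ... | tri> _ _ b<a = b , closed x b<a a∈ , b∈
  opn : ∀ {q} → q ∈ cut x → q ∈ cut y → ∃ λ r → q ℚ.< r × r ∈ cut x ∩ cut y
  opn q∈x q∈y with open′ x q∈x | open′ y q∈y
  ... | a , q<a , a∈ | b , q<b , b∈ with ℚ.<-cmp a b
  ... | tri< a<b _ _ = a , q<a , a∈ , closed y a<b b∈
  ... | tri≈ _ refl _ = a , q<a , a∈ , b∈
  ... | tri> _ _ b<a = b , q<b , closed x b<a a∈ , b∈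

∣_∣ᴿ : ℝ → ℝ
∣ x ∣ᴿ = maxᴿ x (-ᴿ x)

------------------------------------------------------------------------
-- The unit interval

record 𝕀 : Set₁ where
  field
    real : ℝ
    0≤   : 0ᴿ ≤ᴿ real
    ≤1   : real ≤ᴿ 1ᴿ

open 𝕀 public using (real)
open 𝕀

infix 4 _≤_ _<_ _≈_
infixr 7 _∧_
infixr 6 _∨_

_≤_ _<_ _≈_ : 𝕀 → 𝕀 → Set
x ≤ y = real x ≤ᴿ real y
x < y = real x <ᴿ real y
x ≈ y = x ≤ y × y ≤ x

private
  0<1 : 0ℚ ℚ.< 1ℚ
  0<1 = ℚ.positive⁻¹ 1ℚ

𝟘 𝟙 : 𝕀
𝟘 = record { real = 0ᴿ ; 0≤ = id ; ≤1 = λ q<0 → ℚ.<-trans q<0 0<1 }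
𝟙 = record { real = 1ᴿ ; 0≤ = λ q<0 → ℚ.<-trans q<0 0<1 ; ≤1 = id }

_∧_ _∨_ : 𝕀 → 𝕀 → 𝕀
x ∧ y = record
  { real = minᴿ (real x) (real y) ; 0≤ = λ q<0 → 0≤ x q<0 , 0≤ y q<0 ; ≤1 = ≤1 x ∘ proj₁ }
x ∨ y = record
  { real = maxᴿ (real x) (real y) ; 0≤ = inj₁ ∘ 0≤ x ; ≤1 = Sum.[ ≤1 x , ≤1 y ] }

-- The disjunct q < 0 only matters for the empty family, where it gives 𝟘.
⋁ : {J : Set} → (J → 𝕀) → 𝕀
⋁ {J} f = record
  { real = record
    { cut       = λ q → q ℚ.< 0ℚ ⊎ ∃ λ j → q ∈ cut (real (f j))
    ; inhabited = 0ℚ ℚ.- 1ℚ , inj₁ (p-1<p 0ℚ)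
    ; proper    = 1ℚ , λ q∈ → ℚ.<-irrefl refl (upper q∈)
    ; closed    = λ p<q → Sum.map (ℚ.<-trans p<q) (λ (j , q∈) → j , closed (real (f j)) p<q q∈)
    ; open′     = λ { (inj₁ q<0) → let (m , q<m , m<0) = ℚ.<-dense q<0 in m , q<m , inj₁ m<0
                    ; (inj₂ (j , q∈)) → let (r , q<r , r∈) = open′ (real (f j)) q∈ in
                                        r , q<r , inj₂ (j , r∈) }
    }
  ; 0≤ = inj₁
  ; ≤1 = upper
  }
  where
  upper : ∀ {q} → q ℚ.< 0ℚ ⊎ (∃ λ j → q ∈ cut (real (f j))) → q ℚ.< 1ℚ
  upper (inj₁ q<0)      = ℚ.<-trans q<0 0<1
  upper (inj₂ (j , q∈)) = ≤1 (f j) q∈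

-- An intersection of cuts may have a largest element, hence the r > q.
-- The conjunct q < 1 only matters for the empty family, where it gives 𝟙.
⋀ : {J : Set} → (J → 𝕀) → 𝕀
⋀ {J} f = record
  { real = record
    { cut       = λ q → q ℚ.< 1ℚ × ∃ λ r → q ℚ.< r × (∀ j → r ∈ cut (real (f j)))
    ; inhabited = 0ℚ ℚ.- 1ℚ , lower (p-1<p 0ℚ)
    ; proper    = 1ℚ , λ (1<1 , _) → ℚ.<-irrefl refl 1<1
    ; closed    = λ { p<q (q<1 , r , q<r , h) → ℚ.<-trans p<q q<1 , r , ℚ.<-trans p<q q<r , h }
    ; open′     = λ { (q<1 , r , q<r , h) → opn q<1 q<r h }
    }
  ; 0≤ = lower
  ; ≤1 = proj₁
  }
  where
  C : Pred ℚ 0ℓ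
  C q = q ℚ.< 1ℚ × ∃ λ r → q ℚ.< r × (∀ j → r ∈ cut (real (f j)))
  lower : ∀ {q} → q ℚ.< 0ℚ → C q
  lower q<0 = let (m , q<m , m<0) = ℚ.<-dense q<0 in
    ℚ.<-trans q<0 0<1 , m , q<m , λ j → 0≤ (f j) m<0
  opn : ∀ {q r} → q ℚ.< 1ℚ → q ℚ.< r → (∀ j → r ∈ cut (real (f j))) → ∃ λ m → q ℚ.< m × C m
  opn {q} {r} q<1 q<r h with ℚ.<-cmp r 1ℚ
  ... | tri< r<1 _ _ = let (m , q<m , m<r) = ℚ.<-dense q<r in
                       m , q<m , ℚ.<-trans m<r r<1 , r , m<r , h
  ... | tri≈ _ refl _ = let (m , q<m , m<r) = ℚ.<-dense q<r in
                       m , q<m , m<r , r , m<r , h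
  ... | tri> _ _ 1<r = let (m , q<m , m<1) = ℚ.<-dense q<1 in
                       m , q<m , m<1 , r , ℚ.<-trans m<1 1<r , h

⋁-upper : {J : Set} (f : J → 𝕀) → ∀ j → f j ≤ ⋁ f
⋁-upper f j q∈ = inj₂ (j , q∈)

⋁-least : {J : Set} (f : J → 𝕀) (y : 𝕀) → (∀ j → f j ≤ y) → ⋁ f ≤ y
⋁-least f y h (inj₁ q<0)      = 0≤ y q<0
⋁-least f y h (inj₂ (j , q∈)) = h j q∈

⋀-lower : {J : Set} (f : J → 𝕀) → ∀ j → ⋀ f ≤ f j
⋀-lower f j (_ , r , q<r , h) = closed (real (f j)) q<r (h j)

⋀-greatest : {J : Set} (f : J → 𝕀) (y : 𝕀) → (∀ j → y ≤ f j) → y ≤ ⋀ f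
⋀-greatest f y h q∈ = let (r , q<r , r∈) = open′ (real y) q∈ in
  ≤1 y q∈ , r , q<r , λ j → h j r∈

⋁[_]_ : {A : Set} → Pred A 0ℓ → (A → 𝕀) → 𝕀
⋁[ T ] f = ⋁ {J = Σ _ T} (f ∘ proj₁)

infix 4 _⟶_

_⟶_ : (ℕ → 𝕀) → 𝕀 → Set₁
x ⟶ l = ∀ (ε : ℝ) → 0ᴿ <ᴿ ε → ∃ λ N → ∀ n → N ℕ.≤ n → ∣ real (x n) -ᴿ real l ∣ᴿ <ᴿ ε

------------------------------------------------------------------------
-- Possibilistic Kripke structures

record PKS : Set₁ where
  field
    S         : Set
    countable : S ↣ ℕ
    nonempty  : S
    P         : S → S → 𝕀
    P-normal  : ∀ s → ⋁ (P s) ≈ 𝟙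
    I         : S → 𝕀
    I-normal  : ⋁ I ≈ 𝟙
    AP        : Set
    L         : S → Pred AP 0ℓ

  _≟_ : DecidableEquality S
  _≟_ = ℕ.eq? countable

  P[_,_] : S → Pred S 0ℓ → 𝕀
  P[ s , T ] = ⋁[ T ] (P s)

  Paths : Set
  Paths = Σ (ℕ → S) λ π → ∀ i → 𝟘 < P (π i) (π (suc i))

  infixl 9 _!_
  _!_ : Paths → ℕ → S
  π ! i = proj₁ π i

  PathsFrom : S → Pred Paths 0ℓ
  PathsFrom s π = π ! 0 ≡ s

  Po-path : Paths → 𝕀
  Po-path π = I (π ! 0) ∧ ⋀ (λ i → P (π ! i) (π ! suc i))

  Po : Pred Paths 0ℓ → 𝕀
  Po E = ⋁[ E ] Po-path

  _𝖴_ : Pred S 0ℓ → Pred S 0ℓ → Pred Paths 0ℓ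
  (C 𝖴 D) π = ∃ λ k → π ! k ∈ D × (∀ i → i ℕ.< k → π ! i ∈ C)

  _𝖴[≤_]_ : Pred S 0ℓ → ℕ → Pred S 0ℓ → Pred Paths 0ℓ
  (C 𝖴[≤ n ] D) π = ∃ λ k → k ℕ.≤ n × π ! k ∈ D × (∀ i → i ℕ.< k → π ! i ∈ C)

  point : S → S → 𝕀
  point s t = if does (s ≟ t) then 𝟙 else 𝟘

  point-normal : ∀ s → ⋁ (point s) ≈ 𝟙
  point-normal s = ≤1 (⋁ (point s)) , λ {q} q<1 → inj₂ (s , at-s q<1)
    where
    at-s : 𝟙 ≤ point s s
    at-s = subst (λ b → 𝟙 ≤ (if b then 𝟙 else 𝟘)) (sym (dec-true (s ≟ s) refl)) id

infix 10 _⟨_⟩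

_⟨_⟩ : (M : PKS) → PKS.S M → PKS
M ⟨ s ⟩ = record
  { S = S ; countable = countable ; nonempty = nonempty
  ; P = P ; P-normal = P-normal
  ; I = point s ; I-normal = point-normal s
  ; AP = AP ; L = L
  }
  where open PKS M

-- M and M ⟨ s ⟩ have definitionally the same paths.
Po[_,_⊨_] : (M : PKS) → PKS.S M → Pred (PKS.Paths M) 0ℓ → 𝕀
Po[ M , s ⊨ E ] = PKS.Po (M ⟨ s ⟩) (E ∩ PKS.PathsFrom M s)

------------------------------------------------------------------------
-- Vectors over a subset and the operator Φ

-- Blocks may be empty.
record IsPartition {A : Set} (X Y Z : Pred A 0ℓ) : Set where
  field
    cover : U ⊆ X ∪ (Y ∪ Z)
    X⊥Y   : X ⊥ Y
    X⊥Z   : X ⊥ Z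
    Y⊥Z   : Y ⊥ Z

-- Membership in T is proof-irrelevant here, so that a vector has a single
-- entry for each element of T.
Vector : {A : Set} → Pred A 0ℓ → Set₁
Vector {A} T = Refinement A T → 𝕀

module _ {A : Set} {T : Pred A 0ℓ} where

  infix 4 _≤ᵛ_ _≈ᵛ_

  _≤ᵛ_ _≈ᵛ_ : Vector T → Vector T → Set
  X ≤ᵛ Y = ∀ s → X s ≤ Y s
  X ≈ᵛ Y = ∀ s → X s ≈ Y s

  𝟘ᵛ : Vector T
  𝟘ᵛ _ = 𝟘

  _∨ᵛ_ : Vector T → Vector T → Vector T
  (X ∨ᵛ Y) s = X s ∨ Y s

  _⊚_ : (Refinement A T → Refinement A T → 𝕀) → Vector T → Vector T
  (Q ⊚ Y) s = ⋁ λ t → Q s t ∧ Y t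

  IsLeastFixedPoint : (Vector T → Vector T) → Vector T → Set₁
  IsLeastFixedPoint F X = F X ≈ᵛ X × (∀ Y → F Y ≈ᵛ Y → X ≤ᵛ Y)

module _ (M : PKS) (S₌₁ S? : Pred (PKS.S M) 0ℓ) where
  open PKS M

  Aᴹ : Refinement S S? → Refinement S S? → 𝕀
  Aᴹ s t = P (value s) (value t)

  bᴹ : Vector S?
  bᴹ s = P[ value s , S₌₁ ]

  Φ : Vector S? → Vector S?
  Φ Y = (Aᴹ ⊚ Y) ∨ᵛ bᴹ

  Φ-iter : ℕ → Vector S?
  Φ-iter zero    = 𝟘ᵛ
  Φ-iter (suc n) = Φ (Φ-iter n)

Po-vector : (M : PKS) (T : Pred (PKS.S M) 0ℓ) → Pred (PKS.Paths M) 0ℓ → Vector T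
Po-vector M T E s = Po[ M , value s ⊨ E ]

{-# OPTIONS --safe #-}

-- A rational q ∈ [0,1) lies below Po(s ⊨ C U≤n D) exactly when a finite path
-- of at most n transitions, each of possibility above q, leads from s through
-- C into D: normality of P extends such a path to an infinite one by always
-- choosing a transition above q.  Unfolding the first transition identifies
-- the iterates of Φ with these values for D = S₌₁; a path cannot pass
-- through S₌₀, since from there it would still reach B with positive
-- possibility.  Hence X is the supremum of the iterates, and as Φ preserves
-- suprema of increasing sequences, X is its least fixed point (Kleene).
module Submission where

open import Defs
open import Axiom.ExcludedMiddle using (ExcludedMiddle)
open import Data.Bool.Base using (if_then_else_)
open import Data.Empty using (⊥-elim)
open import Data.Integer.Base as ℤ using (+_; -[1+_]; +≤+; -≤+)
import Data.Integer.Properties as ℤ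
open import Data.Irrelevant using ([_])
open import Data.Nat.Base as ℕ using (ℕ; zero; suc; z≤n; s≤s; z<s; s<s)
open import Data.Nat.Coprimality as Coprimality using (1-coprimeTo)
import Data.Nat.Properties as ℕ
open import Data.Product.Base using (∃; _×_; _,_; proj₁; proj₂)
open import Data.Rational.Base as ℚ using (ℚ; 0ℚ; 1ℚ; mkℚ)
import Data.Rational.Properties as ℚ
open import Data.Rational.Solver using (module +-*-Solver)
open import Data.Refinement.Base using (Refinement; value; _,_)
open import Data.Sum.Base using (inj₁; inj₂; [_,_]′)
open import Function.Base using (_∘_; id)
open import Level using (0ℓ)
open import Relation.Binary.PropositionalEquality using (_≡_; refl; sym; trans; cong; subst; subst₂)
open import Relation.Nullary.Decidable using (yes; no; dec-true; recompute)
open import Relation.Nullary.Negation using (¬_; contradiction)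
open import Relation.Unary using (Pred; _∈_; _∉_; _⊆_; _≐_; _∪_; ∁)

open ℝ
open 𝕀
open +-*-Solver using (solve; _:=_; _:+_; _:*_; :-_; con)

≤⇒≯ : ∀ {p q} → p ℚ.≤ q → ¬ (q ℚ.< p)
≤⇒≯ p≤q q<p = ℚ.<-irrefl refl (ℚ.≤-<-trans p≤q q<p)

-- The Archimedean property of ℚ

private
  fromℕ : ℕ → ℚ
  fromℕ n = mkℚ (+ n) 0 (Coprimality.sym (1-coprimeTo n))

fromℕ-suc : ∀ n → fromℕ (suc n) ≡ 1ℚ ℚ.+ fromℕ n
fromℕ-suc n = trans (sym (ℚ.↥p/↧p≡p (fromℕ (suc n))))
  (cong (ℚ._/ 1) (cong (λ i → (+ 1) ℤ.+ i) (sym (ℤ.*-identityʳ (+ n)))))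

-- A denominator is at least 1, so dropping it cannot decrease a nonnegative fraction.
p≤fromℕ∣↥p∣ : ∀ p → p ℚ.≤ fromℕ ℤ.∣ ℚ.↥ p ∣
p≤fromℕ∣↥p∣ (mkℚ (+ n) d _) = ℚ.*≤* (ℤ.*-monoˡ-≤-nonNeg (+ n) (+≤+ (s≤s z≤n)))
p≤fromℕ∣↥p∣ (mkℚ -[1+ n ] d _) = ℚ.*≤* -≤+

archimedean : ∀ p {r} → 0ℚ ℚ.< r → ∃ λ n → p ℚ.≤ fromℕ n ℚ.* r
archimedean p {r} 0<r = n , subst (ℚ._≤ fromℕ n ℚ.* r) p/r*r≡p
  (ℚ.*-monoʳ-≤-nonNeg r (p≤fromℕ∣↥p∣ (p ℚ.* ℚ.1/ r)))
  where
  instance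
    r>0 : ℚ.Positive r
    r>0 = ℚ.positive 0<r
    r≢0 : ℚ.NonZero r
    r≢0 = ℚ.pos⇒nonZero r
    r≥0 : ℚ.NonNegative r
    r≥0 = ℚ.pos⇒nonNeg r
  n : ℕ
  n = ℤ.∣ ℚ.↥ (p ℚ.* ℚ.1/ r) ∣
  p/r*r≡p : p ℚ.* ℚ.1/ r ℚ.* r ≡ p
  p/r*r≡p = trans (ℚ.*-assoc p (ℚ.1/ r) r)
    (trans (cong (p ℚ.*_) (ℚ.*-inverseˡ r)) (ℚ.*-identityʳ p))

-- Lower cuts

closed-≤ : ∀ x {p q} → p ℚ.≤ q → q ∈ cut x → p ∈ cut x
closed-≤ x p≤q q∈ = let (r , q<r , r∈) = open′ x q∈ in closed x (ℚ.≤-<-trans p≤q q<r) r∈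

-- Descend a grid of mesh `r` from a point outside the cut to `a` inside it: some step must enter.
-- Excluded middle decides each grid point, since a lower cut need not be located.
straddle : ExcludedMiddle 0ℓ → ∀ x {r} → 0ℚ ℚ.< r → ∃ λ p → p ∈ cut x × p ℚ.+ r ∉ cut x
straddle em x {r} 0<r = search (proj₁ steps) far
  where
  a b : ℚ
  a = proj₁ (inhabited x)
  b = proj₁ (proper x)
  steps : ∃ λ n → b ℚ.- a ℚ.≤ fromℕ n ℚ.* r
  steps = archimedean (b ℚ.- a) 0<r
  grid : ℕ → ℚ
  grid n = a ℚ.+ fromℕ n ℚ.* r
  grid-zero : grid 0 ≡ a
  grid-zero = solve 2 (λ a r → a :+ con 0ℚ :* r := a) refl a r
  grid-suc : ∀ n → grid (suc n) ≡ grid n ℚ.+ r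
  grid-suc n = trans (cong (λ m → a ℚ.+ m ℚ.* r) (fromℕ-suc n))
    (solve 3 (λ a m r → a :+ (con 1ℚ :+ m) :* r := a :+ m :* r :+ r) refl a (fromℕ n) r)
  b≤grid : b ℚ.≤ grid (proj₁ steps)
  b≤grid = subst (ℚ._≤ grid (proj₁ steps)) (solve 2 (λ a b → a :+ (b :+ :- a) := b) refl a b)
    (ℚ.+-monoʳ-≤ a (proj₂ steps))
  far : grid (proj₁ steps) ∉ cut x
  far = proj₂ (proper x) ∘ closed-≤ x b≤grid
  search : ∀ n → grid n ∉ cut x → ∃ λ p → p ∈ cut x × p ℚ.+ r ∉ cut x
  search zero    h = contradiction (subst (cut x) (sym grid-zero) (proj₂ (inhabited x))) h
  search (suc n) h with em {grid n ∈ cut x}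
  ... | yes g∈ = grid n , g∈ , h ∘ subst (cut x) (sym (grid-suc n))
  ... | no g∉  = search n g∉

-- Negative rationals belong to the cut of every element of the unit interval.
≤-nonNeg : ∀ x y → (∀ {q} → 0ℚ ℚ.≤ q → q ∈ cut (real x) → q ∈ cut (real y)) → x ≤ y
≤-nonNeg x y h {q} q∈ with q ℚ.<? 0ℚ
... | yes q<0 = 0≤ y q<0
... | no q≮0  = h (ℚ.≮⇒≥ q≮0) q∈

-- Convergence of increasing sequences to their supremum

increasing⇒mono : (x : ℕ → 𝕀) → (∀ n → x n ≤ x (suc n)) → ∀ {m n} → m ℕ.≤ n → x m ≤ x n
increasing⇒mono x inc {m} m≤n = go (ℕ.≤⇒≤′ m≤n)
  where
  go : ∀ {n} → m ℕ.≤′ n → x m ≤ x n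
  go (ℕ.≤′-reflexive refl) q∈ = q∈
  go (ℕ.≤′-step {n} m≤′n) q∈ = inc n (go m≤′n q∈)

increasing⇒⟶ : ExcludedMiddle 0ℓ → (x : ℕ → 𝕀) (l : 𝕀) →
  (∀ n → x n ≤ x (suc n)) → l ≈ ⋁ x → x ⟶ l
increasing⇒⟶ em x l inc (l≤⋁ , ⋁≤l) ε (e , e≮0 , e∈ε) = N , λ n N≤n →
  r , [ r∉x-l n , r∉l-x n N≤n ]′ , r∈ε
  where
  -- The witness `e` may be 0; a larger element of `ε` is positive and still separates strictly.
  r : ℚ
  r = proj₁ (open′ ε e∈ε)
  r∈ε : r ∈ cut ε
  r∈ε = proj₂ (proj₂ (open′ ε e∈ε))
  0<r : 0ℚ ℚ.< r
  0<r = ℚ.≤-<-trans (ℚ.≮⇒≥ e≮0) (proj₁ (proj₂ (open′ ε e∈ε)))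
  near : ∃ λ p → p ∈ cut (real l) × p ℚ.+ r ∉ cut (real l)
  near = straddle em (real l) 0<r
  p : ℚ
  p = proj₁ near
  eventually : p ∈ cut (real (⋁ x)) → ∃ λ N → ∀ n → N ℕ.≤ n → p ∈ cut (real (x n))
  eventually (inj₁ p<0)      = 0 , λ n _ → 0≤ (x n) p<0
  eventually (inj₂ (N , p∈)) = N , λ n N≤n → increasing⇒mono x inc N≤n p∈
  reached : ∃ λ N → ∀ n → N ℕ.≤ n → p ∈ cut (real (x n))
  reached = eventually (l≤⋁ (proj₁ (proj₂ near)))
  N : ℕ
  N = proj₁ reached
  r∉x-l : ∀ n → r ∉ cut (real (x n) -ᴿ real l)
  -- Since `a` lies in `l` and `- c` does not, `a + b < - c + c = 0`.
  r∉x-l n (a , b , a∈ , (c , b<c , -c∉) , r≡a+b) = ℚ.<-asym 0<r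
    (subst₂ ℚ._<_ (sym r≡a+b) (ℚ.+-inverseˡ c)
      (ℚ.+-mono-< (below (real l) (⋁≤l (inj₂ (n , a∈))) -c∉) b<c))
  r∉l-x : ∀ n → N ℕ.≤ n → r ∉ cut (-ᴿ (real (x n) -ᴿ real l))
  -- Split `- d` as `p + (- d - p)`: `p` lies in `x n`, and `- d - p < - r - p`, whose negative
  -- `p + r` is outside `l`.
  r∉l-x n N≤n (d , r<d , -d∉) = -d∉
    ( p , ℚ.- d ℚ.- p , proj₂ reached n N≤n
    , ( ℚ.- r ℚ.- p , ℚ.+-monoˡ-< (ℚ.- p) (ℚ.neg-antimono-< r<d)
      , proj₂ (proj₂ near) ∘ subst (cut (real l))
          (solve 2 (λ r p → :- (:- r :+ :- p) := p :+ r) refl r p) )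
    , solve 2 (λ d p → :- d := p :+ (:- d :+ :- p)) refl d p )

-- Kleene iteration

module Kleene (M : PKS) (S₌₁ S? : Pred (PKS.S M) 0ℓ) where

  private
    F : Vector S? → Vector S?
    F = Φ M S₌₁ S?
    iter : ℕ → Vector S?
    iter = Φ-iter M S₌₁ S?

  Φ-mono : ∀ Y Z → Y ≤ᵛ Z → F Y ≤ᵛ F Z
  Φ-mono _ _ Y≤Z s (inj₁ (inj₁ q<0))             = inj₁ (inj₁ q<0)
  Φ-mono _ _ Y≤Z s (inj₁ (inj₂ (t , q∈P , q∈Y))) = inj₁ (inj₂ (t , q∈P , Y≤Z t q∈Y))
  Φ-mono _ _ Y≤Z s (inj₂ q∈b)                    = inj₂ q∈b

  Φ-iter-increasing : ∀ n → iter n ≤ᵛ iter (suc n)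
  Φ-iter-increasing zero    s = 0≤ (iter 1 s)
  Φ-iter-increasing (suc n) s = Φ-mono (iter n) (iter (suc n)) (Φ-iter-increasing n) s

  Φ-iter-least : ∀ Y → F Y ≤ᵛ Y → ∀ n → iter n ≤ᵛ Y
  Φ-iter-least Y ΦY≤Y zero    s = 0≤ (Y s)
  Φ-iter-least Y ΦY≤Y (suc n) s q∈ = ΦY≤Y s (Φ-mono (iter n) Y (Φ-iter-least Y ΦY≤Y n) s q∈)

  -- Continuity of `Φ` along the iterates: membership in the cut of `(A ⊚ X) s` is witnessed by a
  -- single `t`, and membership in that of `X t` by a single iterate.
  ⋁iter-leastFixedPoint : (X : Vector S?) → (∀ s → X s ≈ ⋁ (λ n → iter n s)) →
    IsLeastFixedPoint F X
  ⋁iter-leastFixedPoint X X≈⋁ = (λ s → ΦX≤X s , X≤ΦX s) , least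
    where
    iter≤X : ∀ n → iter n ≤ᵛ X
    iter≤X n s q∈ = proj₂ (X≈⋁ s) (inj₂ (n , q∈))
    ΦX≤X : F X ≤ᵛ X
    ΦX≤X s (inj₁ (inj₁ q<0)) = 0≤ (X s) q<0
    ΦX≤X s (inj₁ (inj₂ (t , q∈P , q∈X))) with proj₁ (X≈⋁ t) q∈X
    ... | inj₁ q<0      = 0≤ (X s) q<0
    ... | inj₂ (n , q∈) = iter≤X (suc n) s (inj₁ (inj₂ (t , q∈P , q∈)))
    ΦX≤X s (inj₂ q∈b) = iter≤X 1 s (inj₂ q∈b)
    X≤ΦX : X ≤ᵛ F X
    X≤ΦX s q∈X with proj₁ (X≈⋁ s) q∈X
    ... | inj₁ q<0      = 0≤ (F X s) q<0
    ... | inj₂ (n , q∈) = Φ-mono (iter n) X (iter≤X n) s (Φ-iter-increasing n s q∈)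
    least : ∀ Y → F Y ≈ᵛ Y → X ≤ᵛ Y
    least Y ΦY≈Y s q∈X = ⋁-least (λ n → iter n s) (Y s)
      (λ n → Φ-iter-least Y (λ t → proj₁ (ΦY≈Y t)) n s) (proj₁ (X≈⋁ s) q∈X)

-- Finite witnesses of until events

module Reachability (M : PKS) where
  open PKS M

  -- The index bounds the number of transitions, so `here` may stop with budget left. Cuts have no
  -- largest element, so each transition taken is strictly above `q`.
  data Reach (q : ℚ) (C D : Pred S 0ℓ) : ℕ → S → Set where
    here : ∀ {n s} → s ∈ D → Reach q C D n s
    step : ∀ {n s t} → s ∈ C → q ∈ cut (real (P s t)) → Reach q C D n t → Reach q C D (suc n) s

  private variable
    C D : Pred S 0ℓ
    q r : ℚ
    n : ℕ
    s : S

  Reach-closed : q ℚ.< r → Reach r C D n s → Reach q C D n s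
  Reach-closed q<r (here s∈D) = here s∈D
  Reach-closed q<r (step {s = s} {t} s∈C r∈P ρ) =
    step s∈C (closed (real (P s t)) q<r r∈P) (Reach-closed q<r ρ)

  -- Only finitely many transitions occur, so one `r` above `q` fits below all of them, as `⋀`
  -- demands.
  Reach-open : q ℚ.< 1ℚ → Reach q C D n s → ∃ λ r → q ℚ.< r × r ℚ.< 1ℚ × Reach r C D n s
  Reach-open q<1 (here s∈D) = let (r , q<r , r<1) = ℚ.<-dense q<1 in r , q<r , r<1 , here s∈D
  Reach-open q<1 (step {s = s} {t} s∈C q∈P ρ) with Reach-open q<1 ρ | open′ (real (P s t)) q∈P
  ... | a , q<a , a<1 , ρ′ | b , q<b , b∈P with a ℚ.<? b
  ... | yes a<b = a , q<a , a<1 , step s∈C (closed (real (P s t)) a<b b∈P) ρ′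
  -- Here `b ≤ a`, possibly with equality; a point strictly below `b` is strictly below both.
  ... | no a≮b with ℚ.<-dense q<b
  ... | c , q<c , c<b = c , q<c , ℚ.<-trans c<a a<1
                      , step s∈C (closed (real (P s t)) c<b b∈P) (Reach-closed c<a ρ′)
    where c<a = ℚ.<-≤-trans c<b (ℚ.≮⇒≥ a≮b)

  Reach-mono-D : ∀ {D′} → D ⊆ D′ → Reach q C D n s → Reach q C D′ n s
  Reach-mono-D D⊆D′ (here s∈D)       = here (D⊆D′ s∈D)
  Reach-mono-D D⊆D′ (step s∈C q∈P ρ) = step s∈C q∈P (Reach-mono-D D⊆D′ ρ)

  Reach-bind : ∀ {D′} → (∀ {t} → t ∈ D → ∃ λ m → Reach q C D′ m t) →
    Reach q C D n s → ∃ λ m → Reach q C D′ m s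
  Reach-bind h (here s∈D)       = h s∈D
  Reach-bind h (step s∈C q∈P ρ) = let (m , ρ′) = Reach-bind h ρ in suc m , step s∈C q∈P ρ′

  sequence⇒Reach : (π : ℕ → S) → (∀ i → q ∈ cut (real (P (π i) (π (suc i))))) →
    ∀ k → k ℕ.≤ n → π k ∈ D → (∀ i → i ℕ.< k → π i ∈ C) → Reach q C D n (π 0)
  sequence⇒Reach π q∈P zero    _         πk∈D _    = here πk∈D
  sequence⇒Reach π q∈P (suc k) (s≤s k≤n) πk∈D πi∈C = step (πi∈C 0 z<s) (q∈P 0)
    (sequence⇒Reach (π ∘ suc) (q∈P ∘ suc) k k≤n πk∈D (λ i i<k → πi∈C (suc i) (s<s i<k)))

  module Extension {r : ℚ} (0≤r : 0ℚ ℚ.≤ r) (r<1 : r ℚ.< 1ℚ) where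

    -- The supremum 1 of the possibilities leaving `s` need not be attained, but some transition
    -- exceeds any `r < 1`; `0 ≤ r` excludes the default disjunct of `⋁`.
    next : ∀ s → ∃ λ t → r ∈ cut (real (P s t))
    next s with proj₂ (P-normal s) r<1
    ... | inj₁ r<0 = contradiction r<0 (≤⇒≯ 0≤r)
    ... | inj₂ t   = t

    greedy : S → ℕ → S
    greedy s zero    = s
    greedy s (suc i) = greedy (proj₁ (next s)) i

    greedy-P : ∀ s i → r ∈ cut (real (P (greedy s i) (greedy s (suc i))))
    greedy-P s zero    = proj₂ (next s)
    greedy-P s (suc i) = greedy-P (proj₁ (next s)) i

    extend : Reach r C D n s → ℕ → S
    extend {s = s} (here _)     i       = greedy s i
    extend {s = s} (step _ _ ρ) zero    = s
    extend         (step _ _ ρ) (suc i) = extend ρ i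

    extend-start : (ρ : Reach r C D n s) → extend ρ 0 ≡ s
    extend-start (here _)     = refl
    extend-start (step _ _ _) = refl

    extend-P : (ρ : Reach r C D n s) → ∀ i → r ∈ cut (real (P (extend ρ i) (extend ρ (suc i))))
    extend-P {s = s} (here _) i = greedy-P s i
    extend-P {s = s} (step _ r∈P ρ) zero =
      subst (λ t → r ∈ cut (real (P s t))) (sym (extend-start ρ)) r∈P
    extend-P (step _ _ ρ) (suc i) = extend-P ρ i

    extend-until : (ρ : Reach r C D n s) →
      ∃ λ k → k ℕ.≤ n × extend ρ k ∈ D × (∀ i → i ℕ.< k → extend ρ i ∈ C)
    extend-until (here s∈D) = 0 , z≤n , s∈D , λ _ ()
    extend-until (step s∈C r∈P ρ) with extend-until ρ
    ... | k , k≤n , k∈D , i∈C = suc k , s≤s k≤n , k∈D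
                              , λ { zero _ → s∈C ; (suc i) (s≤s i<k) → i∈C i i<k }

    extend-path : Reach r C D n s → Paths
    -- Being nonnegative, `r` itself separates every transition from 0.
    extend-path ρ = extend ρ , λ i → r , ≤⇒≯ 0≤r , extend-P ρ i

  𝟙≤point : ∀ {s t} → t ≡ s → 𝟙 ≤ point s t
  𝟙≤point {s} refl = subst (λ b → 𝟙 ≤ (if b then 𝟙 else 𝟘)) (sym (dec-true (s ≟ s) refl)) id

  Po⇒Reach : 0ℚ ℚ.≤ q → q ∈ cut (real Po[ M , s ⊨ C 𝖴[≤ n ] D ]) → Reach q C D n s
  Po⇒Reach 0≤q (inj₁ q<0) = contradiction q<0 (≤⇒≯ 0≤q)
  Po⇒Reach 0≤q (inj₂ ((π , (k , k≤n , k∈D , i∈C) , refl) , _ , q∈⋀)) =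
    sequence⇒Reach (proj₁ π) (λ i → ⋀-lower (λ i → P (π ! i) (π ! suc i)) i q∈⋀) k k≤n k∈D i∈C

  -- Raise `q` to some `r` along the finite path, then extend with all later transitions above `r`:
  -- the infimum of the infinite path stays above `q`.
  Reach⇒Po : 0ℚ ℚ.≤ q → q ℚ.< 1ℚ → Reach q C D n s → q ∈ cut (real Po[ M , s ⊨ C 𝖴[≤ n ] D ])
  Reach⇒Po 0≤q q<1 ρ with Reach-open q<1 ρ
  ... | r , q<r , r<1 , ρ′ = inj₂
    ( (extend-path ρ′ , extend-until ρ′ , extend-start ρ′)
    , 𝟙≤point (extend-start ρ′) q<1 , q<1 , r , q<r , extend-P ρ′ )
    where open Extension (ℚ.≤-trans 0≤q (ℚ.<⇒≤ q<r)) r<1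

  -- The step at which a path reaches `D` serves as its own bound.
  Po-𝖴≈⋁ : ∀ s C D → Po[ M , s ⊨ C 𝖴 D ] ≈ ⋁ (λ n → Po[ M , s ⊨ C 𝖴[≤ n ] D ])
  Po-𝖴≈⋁ s C D = to , from
    where
    to : Po[ M , s ⊨ C 𝖴 D ] ≤ ⋁ (λ n → Po[ M , s ⊨ C 𝖴[≤ n ] D ])
    to (inj₁ q<0) = inj₁ q<0
    to (inj₂ ((π , (k , h) , π₀≡s) , q∈)) =
      inj₂ (k , inj₂ ((π , (k , ℕ.≤-refl , h) , π₀≡s) , q∈))
    from : ⋁ (λ n → Po[ M , s ⊨ C 𝖴[≤ n ] D ]) ≤ Po[ M , s ⊨ C 𝖴 D ]
    from (inj₁ q<0) = inj₁ q<0
    from (inj₂ (_ , inj₁ q<0)) = inj₁ q<0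
    from (inj₂ (_ , inj₂ ((π , (k , _ , h) , π₀≡s) , q∈))) = inj₂ ((π , (k , h) , π₀≡s) , q∈)

  Po-𝖴⇒Reach : 0ℚ ℚ.≤ q → q ∈ cut (real Po[ M , s ⊨ C 𝖴 D ]) → ∃ λ n → Reach q C D n s
  Po-𝖴⇒Reach {s = s} {C} {D} 0≤q q∈ with proj₁ (Po-𝖴≈⋁ s C D) q∈
  ... | inj₁ q<0       = contradiction q<0 (≤⇒≯ 0≤q)
  ... | inj₂ (n , q∈n) = n , Po⇒Reach 0≤q q∈n

  Reach⇒Po-𝖴 : 0ℚ ℚ.≤ q → q ℚ.< 1ℚ → Reach q C D n s → q ∈ cut (real Po[ M , s ⊨ C 𝖴 D ])
  Reach⇒Po-𝖴 {C = C} {D} {n} {s} 0≤q q<1 ρ = proj₂ (Po-𝖴≈⋁ s C D) (inj₂ (n , Reach⇒Po 0≤q q<1 ρ))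

-- Iterates of Φ as step-bounded reachability

module Iterates (em : ExcludedMiddle 0ℓ) (M : PKS) (B C S₌₀ S₌₁ S? : Pred (PKS.S M) 0ℓ)
  (partition : IsPartition S₌₀ S₌₁ S?)
  (B⊆S₌₁ : B ⊆ S₌₁) (S₌₁⊆ : S₌₁ ⊆ (λ s → Po[ M , s ⊨ PKS._𝖴_ M C B ] ≈ 𝟙))
  (⊆S₌₀ : ∁ (C ∪ B) ⊆ S₌₀) (S₌₀⊆ : S₌₀ ⊆ (λ s → Po[ M , s ⊨ PKS._𝖴_ M C B ] ≈ 𝟘)) where
  open PKS M
  open IsPartition partition
  open Reachability M

  -- A state of `S?` outside `C` would be outside `B` too, hence in `S₌₀`.
  S?⊆C : S? ⊆ C
  S?⊆C {s} s∈S? with em {s ∈ C}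
  ... | yes s∈C = s∈C
  ... | no s∉C  = ⊥-elim (X⊥Z (⊆S₌₀ [ s∉C , (λ s∈B → Y⊥Z (B⊆S₌₁ s∈B , s∈S?)) ]′ , s∈S?))

  -- The index carries its membership proof irrelevantly; deciding membership by excluded middle
  -- recovers a usable one.
  value∈S? : (s : Refinement S S?) → value s ∈ S?
  value∈S? (s , [ s∈S? ]) = recompute em s∈S?

  -- From a state of `S₌₁` the event has possibility 1, so a continuation into `B` above `q < 1`
  -- exists.
  Reach-S₌₁⇒B : ∀ {q n s} → 0ℚ ℚ.≤ q → q ℚ.< 1ℚ → Reach q C S₌₁ n s → ∃ λ m → Reach q C B m s
  Reach-S₌₁⇒B 0≤q q<1 = Reach-bind (λ t∈S₌₁ → Po-𝖴⇒Reach 0≤q (proj₂ (S₌₁⊆ t∈S₌₁) q<1))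

  iter⇒Reach : ∀ {q} → 0ℚ ℚ.≤ q → ∀ n s → q ∈ cut (real (Φ-iter M S₌₁ S? n s)) →
    Reach q C S₌₁ n (value s)
  iter⇒Reach 0≤q zero s q<0 = contradiction q<0 (≤⇒≯ 0≤q)
  iter⇒Reach 0≤q (suc n) s (inj₁ (inj₁ q<0)) = contradiction q<0 (≤⇒≯ 0≤q)
  iter⇒Reach 0≤q (suc n) s (inj₁ (inj₂ (t , q∈P , q∈))) =
    step (S?⊆C (value∈S? s)) q∈P (iter⇒Reach 0≤q n t q∈)
  iter⇒Reach 0≤q (suc n) s (inj₂ (inj₁ q<0)) = contradiction q<0 (≤⇒≯ 0≤q)
  iter⇒Reach 0≤q (suc n) s (inj₂ (inj₂ ((u , u∈S₌₁) , q∈P))) =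
    step (S?⊆C (value∈S? s)) q∈P (here u∈S₌₁)

  Reach⇒iter : ∀ {q} → 0ℚ ℚ.≤ q → q ℚ.< 1ℚ → ∀ n s → Reach q C S₌₁ n (value s) →
    q ∈ cut (real (Φ-iter M S₌₁ S? n s))
  -- This also settles `n = 0`, where the iterate vanishes: a state of `S?` is never itself a
  -- target.
  Reach⇒iter 0≤q q<1 n s (here s∈S₌₁) = ⊥-elim (Y⊥Z (s∈S₌₁ , value∈S? s))
  Reach⇒iter 0≤q q<1 (suc n) s (step {t = t} _ q∈P ρ) with cover {t} _
  -- The remaining path continues into `B`, which would put the possibility at `t` above `q ≥ 0`.
  ... | inj₁ t∈S₌₀        = contradiction
    (proj₁ (S₌₀⊆ t∈S₌₀) (Reach⇒Po-𝖴 0≤q q<1 (proj₂ (Reach-S₌₁⇒B 0≤q q<1 ρ)))) (≤⇒≯ 0≤q)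
  ... | inj₂ (inj₁ t∈S₌₁) = inj₂ (inj₂ ((t , t∈S₌₁) , q∈P))
  ... | inj₂ (inj₂ t∈S?)  =
    inj₁ (inj₂ ((t , [ t∈S? ]) , q∈P , Reach⇒iter 0≤q q<1 n (t , [ t∈S? ]) ρ))

  iter≈Po : ∀ n → Φ-iter M S₌₁ S? n ≈ᵛ Po-vector M S? (C 𝖴[≤ n ] S₌₁)
  iter≈Po n s = ≤-nonNeg x y (λ 0≤q q∈ → Reach⇒Po 0≤q (≤1 x q∈) (iter⇒Reach 0≤q n s q∈))
              , ≤-nonNeg y x (λ 0≤q q∈ → Reach⇒iter 0≤q (≤1 y q∈) n s (Po⇒Reach 0≤q q∈))
    where
    x = Φ-iter M S₌₁ S? n s
    y = Po-vector M S? (C 𝖴[≤ n ] S₌₁) s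

  -- Paths into `B` end in `S₌₁`, and paths into `S₌₁` continue into `B`; the supremum over `n`
  -- absorbs the extra steps.
  Po≈⋁iter : ∀ s → Po-vector M S? (C 𝖴 B) s ≈ ⋁ (λ n → Φ-iter M S₌₁ S? n s)
  Po≈⋁iter s = ≤-nonNeg X ⋁iter to
    , ⋁-least (λ n → Φ-iter M S₌₁ S? n s) X (λ n → ≤-nonNeg (Φ-iter M S₌₁ S? n s) X (from n))
    where
    X = Po-vector M S? (C 𝖴 B) s
    ⋁iter = ⋁ (λ n → Φ-iter M S₌₁ S? n s)
    to : ∀ {q} → 0ℚ ℚ.≤ q → q ∈ cut (real X) → q ∈ cut (real ⋁iter)
    to 0≤q q∈ = let (n , ρ) = Po-𝖴⇒Reach 0≤q q∈ in
      inj₂ (n , Reach⇒iter 0≤q (≤1 X q∈) n s (Reach-mono-D B⊆S₌₁ ρ))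
    from : ∀ n {q} → 0ℚ ℚ.≤ q → q ∈ cut (real (Φ-iter M S₌₁ S? n s)) → q ∈ cut (real X)
    from n 0≤q q∈ = let q<1 = ≤1 (Φ-iter M S₌₁ S? n s) q∈ in
      Reach⇒Po-𝖴 0≤q q<1 (proj₂ (Reach-S₌₁⇒B 0≤q q<1 (iter⇒Reach 0≤q n s q∈)))

-- Least fixed point and convergence of the iterates

theorem11 : ExcludedMiddle 0ℓ → (M : PKS) → let open PKS M in
    (B C S₌₀ S₌₁ S? : Pred S 0ℓ) →
    IsPartition S₌₀ S₌₁ S? →
    B ⊆ S₌₁ → S₌₁ ⊆ (λ s → Po[ M , s ⊨ C 𝖴 B ] ≈ 𝟙) →
    ∁ (C ∪ B) ⊆ S₌₀ → S₌₀ ⊆ (λ s → Po[ M , s ⊨ C 𝖴 B ] ≈ 𝟘) →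
    S? ≐ ∁ (S₌₁ ∪ S₌₀) →
    let X = Po-vector M S? (C 𝖴 B)
        X⁽_⁾ = Φ-iter M S₌₁ S?
    in
    IsLeastFixedPoint (Φ M S₌₁ S?) X
    × (∀ n → X⁽ n ⁾ ≈ᵛ Po-vector M S? (C 𝖴[≤ n ] S₌₁))
    × ((∀ n → X⁽ n ⁾ ≤ᵛ X⁽ suc n ⁾) × (∀ n → X⁽ n ⁾ ≤ᵛ X))
    × (∀ s → (λ n → X⁽ n ⁾ s) ⟶ X s)
theorem11 em M B C S₌₀ S₌₁ S? partition B⊆S₌₁ S₌₁⊆ ⊆S₌₀ S₌₀⊆ _ =
    ⋁iter-leastFixedPoint (Po-vector M S? (C 𝖴 B)) Po≈⋁iter
  , iter≈Po
  , (Φ-iter-increasing , λ n s q∈ → proj₂ (Po≈⋁iter s) (inj₂ (n , q∈)))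
  , λ s → increasing⇒⟶ em (λ n → Φ-iter M S₌₁ S? n s) (Po-vector M S? (C 𝖴 B) s)
            (λ n → Φ-iter-increasing n s) (Po≈⋁iter s)
  where
  open PKS M
  open Kleene M S₌₁ S?
  open Iterates em M B C S₌₀ S₌₁ S? partition B⊆S₌₁ S₌₁⊆ ⊆S₌₀ S₌₀⊆
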